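{- Let $k\geq 2$ and $n\geq k+1$ be integers. In the quasi-shuffle algebra $(\mathcal{H},\ast)$, $$ \begin{aligned} \sum_{\substack{ r, s_i\geq 1,\ s_1\geq 2 \\ r+s_1+\cdots +s_{k-1}=n}} z_{r}\ast z_{s_1,\dots, s_{k-1}} = &\sum_{\substack{ t_i\geq 1,\ t_1=1,\ t_2\geq 2 \\ t_1+\cdots+t_{k}=n}} z_{t_1,t_2,\dots, t_{k}} +(k-1) \sum_{\substack{t_i\geq 1,\ t_1\geq 2,\ t_2=1 \\ t_1+\cdots+t_{k}=n }} z_{t_1,\dots,t_{k}}\\ &+k \sum_{\substack{t_i\geq 1,\ t_1\geq 2,\ t_2\geq 2 \\ t_1+\cdots+t_{k}=n}} z_{t_1,\dots, t_{k}} + (n-k) \sum_{\substack{u_i\geq 1,\ u_1\geq 2 \\ u_1+\cdots+u_{k-1}=n }} z_{u_1,\dots, u_{k-1}}. \end{aligned} $$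
   Context: Let $\mathcal{H}$ be the free $\mathbb{Z}$-module on the free monoid generated by letters $z_s$ ($s\geq 1$ an integer); write $z_{s_1,\dots,s_k}:=z_{s_1}z_{s_2}\cdots z_{s_k}$ for a word and $1$ for the empty word. The quasi-shuffle (stuffle) product $\ast$ is the $\mathbb{Z}$-bilinear product on $\mathcal{H}$ defined on words recursively by $1\ast u=u\ast 1=u$ and $(z_{r}u)\ast(z_{s}v)=z_{r}\,(u\ast (z_{s}v))+z_{s}\,((z_{r}u)\ast v)+z_{r+s}\,(u\ast v)$ for words $u,v$ and integers $r,s\geq 1$ (juxtaposition denotes concatenation, extended linearly). -}

module Defs where

open import Data.Empty using (⊥)
open import Data.Integer as ℤ using (ℤ; 0ℤ; 1ℤ)
open import Data.List using (List; []; _∷_; [_]; _++_; map; filter; concatMap; cartesianProduct; cartesianProductWith; upTo)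
open import Data.List.Properties using (≡-dec)
open import Data.Nat using (ℕ; zero; suc; _+_; _≟_; NonZero; >-nonZero; >-nonZero⁻¹)
open import Data.Nat.ListAction using (sum)
open import Data.Nat.Properties using (<-≤-trans; m≤m+n)
open import Data.Product using (_×_; _,_)
open import Level using (0ℓ)
open import Relation.Binary.Definitions using (DecidableEquality)
open import Relation.Binary.PropositionalEquality using (_≡_; refl; cong)
open import Relation.Nullary using (yes; no)
open import Relation.Nullary.Decidable using (map′; _×-dec_)
open import Relation.Unary using (Pred; Decidable)

-- The positivity proof is irrelevant, so a letter is determined by its index.
record Letter : Set where
  constructor z
  field
    index        : ℕ
    .{{index≥1}} : NonZero index

open Letter public using (index)

_≟ᴸ_ : DecidableEquality Letter
r ≟ᴸ s = map′ (λ { refl → refl }) (cong index) (index r ≟ index s)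

_⊕_ : Letter → Letter → Letter
z r ⊕ z s = z (r + s) {{>-nonZero (<-≤-trans (>-nonZero⁻¹ r) (m≤m+n r s))}}

Word : Set
Word = List Letter

_≟ᵂ_ : DecidableEquality Word
_≟ᵂ_ = ≡-dec _≟ᴸ_

weight : Word → ℕ
weight w = sum (map index w)

-- The free ℤ-module on words: formal finite sums of terms (coefficient , word),
-- possibly with repeated words, identified by _≈_ when every word has the same
-- total coefficient.
ℋ : Set
ℋ = List (ℤ × Word)

coeff : ℋ → Word → ℤ
coeff []            w = 0ℤ
coeff ((c , v) ∷ x) w with v ≟ᵂ w
... | yes _ = c ℤ.+ coeff x w
... | no  _ = coeff x w

infix 4 _≈_
_≈_ : ℋ → ℋ → Set
x ≈ y = ∀ w → coeff x w ≡ coeff y w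

⟦_⟧ : Word → ℋ
⟦ w ⟧ = [ (1ℤ , w) ]

infixl 6 _⊞_
_⊞_ : ℋ → ℋ → ℋ
_⊞_ = _++_

infixr 8 _·_
_·_ : ℤ → ℋ → ℋ
c · x = map (λ (a , w) → (c ℤ.* a , w)) x

∑ : {A : Set} → List A → (A → ℋ) → ℋ
∑ xs f = concatMap f xs

infixr 8 _◁_
_◁_ : Letter → ℋ → ℋ
s ◁ x = map (λ (a , w) → (a , s ∷ w)) x

stuffle : Word → Word → ℋ
stuffle []      v       = ⟦ v ⟧
stuffle (r ∷ u) []      = ⟦ r ∷ u ⟧
stuffle (r ∷ u) (s ∷ v) =
  r ◁ stuffle u (s ∷ v) ⊞ s ◁ stuffle (r ∷ u) v ⊞ (r ⊕ s) ◁ stuffle u v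

infixl 7 _∗_
_∗_ : ℋ → ℋ → ℋ
x ∗ y = ∑ x λ (a , u) → ∑ y λ (b , v) → (a ℤ.* b) · stuffle u v

First : Pred ℕ 0ℓ → Pred Word 0ℓ
First P []      = ⊥
First P (s ∷ _) = P (index s)

Second : Pred ℕ 0ℓ → Pred Word 0ℓ
Second P []      = ⊥
Second P (_ ∷ w) = First P w

first? : {P : Pred ℕ 0ℓ} → Decidable P → Decidable (First P)
first? P? []      = no λ ()
first? P? (s ∷ _) = P? (index s)

second? : {P : Pred ℕ 0ℓ} → Decidable P → Decidable (Second P)
second? P? []      = no λ ()
second? P? (_ ∷ w) = first? P? w

letters≤ : ℕ → List Letter
letters≤ n = map (λ i → z (suc i)) (upTo n)

words≤ : ℕ → ℕ → List Word
words≤ n zero    = [ [] ]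
words≤ n (suc k) = cartesianProductWith _∷_ (letters≤ n) (words≤ n k)

-- Index sets are cut out of the tuples with all entries in {1,…,n}. The bound n
-- loses nothing, since positive integers with sum n are all at most n.
compositions : (k n : ℕ) {P : Pred Word 0ℓ} → Decidable P → List Word
compositions k n P? = filter (λ t → (weight t ≟ n) ×-dec P? t) (words≤ n k)

letterCompositions : (k n : ℕ) {P : Pred Word 0ℓ} → Decidable P → List (Letter × Word)
letterCompositions k n P? =
  filter (λ (r , s) → (index r + weight s ≟ n) ×-dec P? s)
         (cartesianProduct (letters≤ n) (words≤ n k))

{-# OPTIONS --safe #-}

-- Both sides are compared coefficientwise. Stuffling is homogeneous in the
-- weight, so for a word w of weight n the constraint on the total weight may be
-- dropped from the left-hand side. What remains counts the ways to obtain w from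
-- some z_r and some word s with first letter at least 2: if w has length k, by
-- choosing the position of the letter r such that deleting it leaves a first
-- letter ≥ 2; if w has length k − 1, by splitting one letter of w as r + s_i,
-- which gives (w₁ − 2) + Σ_{i ≥ 2} (wᵢ − 1) = n − k ways when w₁ ≥ 2. These counts
-- follow from a recursion on the first letter of w.
module Submission where

open import Data.Bool using (true; false; if_then_else_)
open import Data.Integer as ℤ using (ℤ; +_; 0ℤ; 1ℤ)
open import Data.Integer.Properties as ℤₚ using ()
open import Data.Integer.Tactic.RingSolver using (solve-∀)
open import Data.List using (List; []; _∷_; [_]; _++_; map; filter; cartesianProductWith; upTo; length)
open import Data.List.Properties using (map-upTo; ++-identityʳ)
open import Data.List.Relation.Unary.All using (All; []; _∷_)
import Data.List.Relation.Unary.All as All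
open import Data.List.Relation.Unary.All.Properties using (++⁺; map⁺)
open import Data.Nat using (ℕ; zero; suc; _+_; _∸_; _≤_; _<_; _≟_; _≤?_; _<?_; s≤s)
open import Data.Nat.Properties as ℕₚ using ()
open import Data.Nat.Tactic.RingSolver using () renaming (solve-∀ to solveℕ-∀)
open import Data.Product using (_,_)
open import Function using (_∘_; const; mk⇔)
open import Relation.Binary.PropositionalEquality using (_≡_; refl; sym; trans; cong; cong₂; subst; module ≡-Reasoning)
open import Relation.Nullary using (Dec; does; yes; no; ¬_)
open import Relation.Nullary.Decidable using (_×-dec_; dec-true; dec-false; does-⇔)
open import Relation.Unary using (Pred; Decidable)
open import Defs

open ≡-Reasoning

private
  variable
    A B C : Set

-- Indicators and finite sums of integers

-- Only the Boolean of the decision enters, so indicators compute: `ι (suc i ≟ suc j)` is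
-- definitionally `ι (i ≟ j)`, and `ι (r ≟ᴸ s)` is `ι (index r ≟ index s)`.
ι : Dec A → ℤ
ι a? = if does a? then 1ℤ else 0ℤ

ι-yes : (a? : Dec A) → A → ι a? ≡ 1ℤ
ι-yes a? a = cong (if_then 1ℤ else 0ℤ) (dec-true a? a)

ι-no : (a? : Dec A) → ¬ A → ι a? ≡ 0ℤ
ι-no a? ¬a = cong (if_then 1ℤ else 0ℤ) (dec-false a? ¬a)

ι-⇔ : (A → B) → (B → A) → (a? : Dec A) (b? : Dec B) → ι a? ≡ ι b?
ι-⇔ f g a? b? = cong (if_then 1ℤ else 0ℤ) (does-⇔ (mk⇔ f g) a? b?)

ι-× : (a? : Dec A) (b? : Dec B) → ι (a? ×-dec b?) ≡ ι a? ℤ.* ι b?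
ι-× a? b? with does a? | does b?
... | true  | true  = refl
... | true  | false = refl
... | false | _     = refl

-- Under an indicator, an equation is to be proved only where the condition holds. This is how
-- `weight w ≡ n` becomes available as a hypothesis.
ι-*-cong : (a? : Dec A) {x y : ℤ} → (A → x ≡ y) → ι a? ℤ.* x ≡ ι a? ℤ.* y
ι-*-cong (yes a) x≡y = cong (1ℤ ℤ.*_) (x≡y a)
ι-*-cong (no _)  _   = refl

⅀ : List A → (A → ℤ) → ℤ
⅀ []       f = 0ℤ
⅀ (x ∷ xs) f = f x ℤ.+ ⅀ xs f

⅀-cong : (xs : List A) {f g : A → ℤ} → (∀ x → f x ≡ g x) → ⅀ xs f ≡ ⅀ xs g
⅀-cong []       f≗g = refl
⅀-cong (x ∷ xs) f≗g = cong₂ ℤ._+_ (f≗g x) (⅀-cong xs f≗g)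

⅀-zero : (xs : List A) {f : A → ℤ} → (∀ x → f x ≡ 0ℤ) → ⅀ xs f ≡ 0ℤ
⅀-zero []       f≗0 = refl
⅀-zero (x ∷ xs) f≗0 = cong₂ ℤ._+_ (f≗0 x) (⅀-zero xs f≗0)

⅀-+ : (xs : List A) (f g : A → ℤ) → ⅀ xs (λ x → f x ℤ.+ g x) ≡ ⅀ xs f ℤ.+ ⅀ xs g
⅀-+ []       f g = refl
⅀-+ (x ∷ xs) f g = trans (cong (λ y → f x ℤ.+ g x ℤ.+ y) (⅀-+ xs f g)) (interchange (f x) (g x) (⅀ xs f) (⅀ xs g))
  where
  interchange : ∀ a b c d → a ℤ.+ b ℤ.+ (c ℤ.+ d) ≡ a ℤ.+ c ℤ.+ (b ℤ.+ d)
  interchange = solve-∀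

⅀-*ˡ : (xs : List A) (c : ℤ) (f : A → ℤ) → ⅀ xs (λ x → c ℤ.* f x) ≡ c ℤ.* ⅀ xs f
⅀-*ˡ []       c f = sym (ℤₚ.*-zeroʳ c)
⅀-*ˡ (x ∷ xs) c f = trans (cong (λ y → c ℤ.* f x ℤ.+ y) (⅀-*ˡ xs c f)) (sym (ℤₚ.*-distribˡ-+ c (f x) (⅀ xs f)))

⅀-*ʳ : (xs : List A) (c : ℤ) (f : A → ℤ) → ⅀ xs (λ x → f x ℤ.* c) ≡ ⅀ xs f ℤ.* c
⅀-*ʳ xs c f = begin
  ⅀ xs (λ x → f x ℤ.* c) ≡⟨ ⅀-cong xs (λ x → ℤₚ.*-comm (f x) c) ⟩
  ⅀ xs (λ x → c ℤ.* f x) ≡⟨ ⅀-*ˡ xs c f ⟩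
  c ℤ.* ⅀ xs f           ≡⟨ ℤₚ.*-comm c (⅀ xs f) ⟩
  ⅀ xs f ℤ.* c           ∎

⅀-swap : (xs : List A) (ys : List B) (f : A → B → ℤ) →
  ⅀ xs (λ x → ⅀ ys (f x)) ≡ ⅀ ys (λ y → ⅀ xs (λ x → f x y))
⅀-swap []       ys f = sym (⅀-zero ys (λ _ → refl))
⅀-swap (x ∷ xs) ys f = trans (cong (λ y → ⅀ ys (f x) ℤ.+ y) (⅀-swap xs ys f))
  (sym (⅀-+ ys (f x) (λ y → ⅀ xs (λ x′ → f x′ y))))

⅀-++ : (xs ys : List A) (f : A → ℤ) → ⅀ (xs ++ ys) f ≡ ⅀ xs f ℤ.+ ⅀ ys f
⅀-++ []       ys f = sym (ℤₚ.+-identityˡ _)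
⅀-++ (x ∷ xs) ys f = trans (cong (λ y → f x ℤ.+ y) (⅀-++ xs ys f)) (sym (ℤₚ.+-assoc (f x) (⅀ xs f) (⅀ ys f)))

⅀-map : (g : A → B) (xs : List A) (f : B → ℤ) → ⅀ (map g xs) f ≡ ⅀ xs (f ∘ g)
⅀-map g []       f = refl
⅀-map g (x ∷ xs) f = cong (λ y → f (g x) ℤ.+ y) (⅀-map g xs f)

⅀-cartesianProductWith : (_∙_ : A → B → C) (xs : List A) (ys : List B) (f : C → ℤ) →
  ⅀ (cartesianProductWith _∙_ xs ys) f ≡ ⅀ xs (λ x → ⅀ ys (λ y → f (x ∙ y)))
⅀-cartesianProductWith _∙_ []       ys f = refl
⅀-cartesianProductWith _∙_ (x ∷ xs) ys f = trans
  (⅀-++ (map (x ∙_) ys) (cartesianProductWith _∙_ xs ys) f)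
  (cong₂ ℤ._+_ (⅀-map (x ∙_) ys f) (⅀-cartesianProductWith _∙_ xs ys f))

⅀-filter : {P : Pred A _} (P? : Decidable P) (xs : List A) (f : A → ℤ) →
  ⅀ (filter P? xs) f ≡ ⅀ xs (λ x → ι (P? x) ℤ.* f x)
⅀-filter P? []       f = refl
⅀-filter P? (x ∷ xs) f with does (P? x)
... | true  = cong₂ ℤ._+_ (sym (ℤₚ.*-identityˡ (f x))) (⅀-filter P? xs f)
... | false = trans (⅀-filter P? xs f) (sym (ℤₚ.+-identityˡ _))

⅀-upTo-suc : (n : ℕ) (f : ℕ → ℤ) → ⅀ (upTo (suc n)) f ≡ f 0 ℤ.+ ⅀ (upTo n) (f ∘ suc)
⅀-upTo-suc n f = cong (λ y → f 0 ℤ.+ y) (trans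
  (cong (λ xs → ⅀ xs f) (sym (map-upTo suc n)))
  (⅀-map suc (upTo n) f))

⅀-upTo-sift : ∀ {n j} → j < n → (f : ℕ → ℤ) → ⅀ (upTo n) (λ i → ι (i ≟ j) ℤ.* f i) ≡ f j
⅀-upTo-sift {suc n} {zero} _ f = begin
  ⅀ (upTo (suc n)) (λ i → ι (i ≟ 0) ℤ.* f i)             ≡⟨ ⅀-upTo-suc n (λ i → ι (i ≟ 0) ℤ.* f i) ⟩
  1ℤ ℤ.* f 0 ℤ.+ ⅀ (upTo n) (λ i → 0ℤ ℤ.* f (suc i))
    ≡⟨ cong₂ ℤ._+_ (ℤₚ.*-identityˡ (f 0)) (⅀-zero (upTo n) (λ _ → refl)) ⟩
  f 0 ℤ.+ 0ℤ                                             ≡⟨ ℤₚ.+-identityʳ (f 0) ⟩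
  f 0                                                    ∎
⅀-upTo-sift {suc n} {suc j} (s≤s j<n) f = begin
  ⅀ (upTo (suc n)) (λ i → ι (i ≟ suc j) ℤ.* f i)         ≡⟨ ⅀-upTo-suc n (λ i → ι (i ≟ suc j) ℤ.* f i) ⟩
  0ℤ ℤ.+ ⅀ (upTo n) (λ i → ι (i ≟ j) ℤ.* f (suc i))      ≡⟨ ℤₚ.+-identityˡ _ ⟩
  ⅀ (upTo n) (λ i → ι (i ≟ j) ℤ.* f (suc i))             ≡⟨ ⅀-upTo-sift j<n (f ∘ suc) ⟩
  f (suc j)                                              ∎

⅀-upTo-< : ∀ {n m} → m ≤ n → ⅀ (upTo n) (λ i → ι (i <? m)) ≡ + m
⅀-upTo-< {n} {zero} _ = ⅀-zero (upTo n) (λ _ → refl)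
⅀-upTo-< {suc n} {suc m} (s≤s m≤n) = trans (⅀-upTo-suc n (λ i → ι (i <? suc m)))
  (cong (λ y → 1ℤ ℤ.+ y) (⅀-upTo-< m≤n))

-- The only solution is `i = a ∸ suc s`, which exists exactly when `s < a`; the bound `a ≤ n` keeps
-- it in the range of summation.
⅀-upTo-+≟ : ∀ {n a} → a ≤ n → (s : ℕ) → ⅀ (upTo n) (λ i → ι (suc i + s ≟ a)) ≡ ι (s <? a)
⅀-upTo-+≟ {n} {a} a≤n s with s <? a
... | no s≮a = trans
  (⅀-zero (upTo n) (λ i → ι-no (suc i + s ≟ a)
    (λ 1+i+s≡a → s≮a (subst (s <_) 1+i+s≡a (s≤s (ℕₚ.m≤n+m s i))))))
  (sym (ι-no (s <? a) s≮a))
... | yes s<a = begin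
  ⅀ (upTo n) (λ i → ι (suc i + s ≟ a))   ≡⟨ ⅀-cong (upTo n) same ⟩
  ⅀ (upTo n) (λ i → ι (i ≟ j) ℤ.* 1ℤ)    ≡⟨ ⅀-upTo-sift j<n (const 1ℤ) ⟩
  1ℤ                                     ≡⟨ ι-yes (s <? a) s<a ⟨
  ι (s <? a)                             ∎
  where
  j = a ∸ suc s
  1+j+s≡a : suc j + s ≡ a
  1+j+s≡a = trans (sym (ℕₚ.+-suc j s)) (ℕₚ.m∸n+n≡m s<a)
  j<n : j < n
  j<n = ℕₚ.≤-trans (subst (j <_) 1+j+s≡a (s≤s (ℕₚ.m≤m+n j s))) a≤n
  same : ∀ i → ι (suc i + s ≟ a) ≡ ι (i ≟ j) ℤ.* 1ℤ
  same i = trans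
    (ι-⇔ (λ eq → ℕₚ.suc-injective (ℕₚ.+-cancelʳ-≡ s _ _ (trans eq (sym 1+j+s≡a))))
         (λ eq → trans (cong (λ x → suc x + s) eq) 1+j+s≡a) (suc i + s ≟ a) (i ≟ j))
    (sym (ℤₚ.*-identityʳ _))

-- Sums over letters and words of bounded index

⅀-letters : (n : ℕ) (f : Letter → ℤ) → ⅀ (letters≤ n) f ≡ ⅀ (upTo n) (λ i → f (z (suc i)))
⅀-letters n = ⅀-map (λ i → z (suc i)) (upTo n)

⅀-letters-sift : ∀ {n} (a : Letter) → index a ≤ n → (f : Letter → ℤ) →
  ⅀ (letters≤ n) (λ s → ι (s ≟ᴸ a) ℤ.* f s) ≡ f a
⅀-letters-sift {n} (z (suc j)) j<n f = trans (⅀-letters n _) (⅀-upTo-sift j<n (λ i → f (z (suc i))))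

⅀-letters-⊕ : ∀ {n} (a s : Letter) → index a ≤ n →
  ⅀ (letters≤ n) (λ r → ι ((r ⊕ s) ≟ᴸ a)) ≡ ι (index s <? index a)
⅀-letters-⊕ {n} a s a≤n = trans (⅀-letters n _) (⅀-upTo-+≟ a≤n (index s))

-- The factor `1ℤ` is the value `g s` in `stuffleSum-∷` for the constant weight; the sum counts the
-- splittings `a = r ⊕ s`.
⅀-letters-< : ∀ {n} (a : Letter) → index a ≤ n →
  ⅀ (letters≤ n) (λ s → 1ℤ ℤ.* ι (index s <? index a)) ≡ + index a ℤ.- 1ℤ
⅀-letters-< {n} (z (suc j)) j<n = begin
  ⅀ (letters≤ n) (λ s → 1ℤ ℤ.* ι (index s <? suc j)) ≡⟨ ⅀-letters n _ ⟩
  ⅀ (upTo n) (λ i → 1ℤ ℤ.* ι (i <? j))               ≡⟨ ⅀-*ˡ (upTo n) 1ℤ _ ⟩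
  1ℤ ℤ.* ⅀ (upTo n) (λ i → ι (i <? j))               ≡⟨ ℤₚ.*-identityˡ _ ⟩
  ⅀ (upTo n) (λ i → ι (i <? j))                      ≡⟨ ⅀-upTo-< (ℕₚ.<⇒≤ j<n) ⟩
  + j                                                ∎

-- Counts the splittings `a = r ⊕ s` with `index s` at least 2. Truncated subtraction gives the
-- correct value 0 also when `index a` is 1.
⅀-letters-2≤< : ∀ {n} (a : Letter) → index a ≤ n →
  ⅀ (letters≤ n) (λ s → ι (2 ≤? index s) ℤ.* ι (index s <? index a)) ≡ + (index a ∸ 2)
⅀-letters-2≤< {n} (z 1) _ = ⅀-zero (letters≤ n) λ { (z (suc i)) → ℤₚ.*-zeroʳ (ι (2 ≤? suc i)) }
⅀-letters-2≤< {suc n} (z (suc (suc j))) (s≤s j<n) = begin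
  ⅀ (letters≤ (suc n)) (λ s → ι (2 ≤? index s) ℤ.* ι (index s <? suc (suc j)))
    ≡⟨ ⅀-letters (suc n) (λ s → ι (2 ≤? index s) ℤ.* ι (index s <? suc (suc j))) ⟩
  ⅀ (upTo (suc n)) (λ i → ι (2 ≤? suc i) ℤ.* ι (suc i <? suc (suc j)))
    -- The summand at `i = 0` belongs to the letter of index 1, which `2 ≤? 1` excludes; after the
    -- shift the first indicator is constantly 1.
    ≡⟨ ⅀-upTo-suc n (λ i → ι (2 ≤? suc i) ℤ.* ι (suc i <? suc (suc j))) ⟩
  0ℤ ℤ.+ ⅀ (upTo n) (λ i → 1ℤ ℤ.* ι (i <? j))                                  ≡⟨ ℤₚ.+-identityˡ _ ⟩
  ⅀ (upTo n) (λ i → 1ℤ ℤ.* ι (i <? j))                                         ≡⟨ ⅀-*ˡ (upTo n) 1ℤ _ ⟩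
  1ℤ ℤ.* ⅀ (upTo n) (λ i → ι (i <? j))                                         ≡⟨ ℤₚ.*-identityˡ _ ⟩
  ⅀ (upTo n) (λ i → ι (i <? j))                                                ≡⟨ ⅀-upTo-< (ℕₚ.<⇒≤ j<n) ⟩
  + j                                                                          ∎

-- Sums run over letters of index at most `n`, so a target word can be sifted out of them only if
-- its letters lie in that range.
Bounded : ℕ → Word → Set
Bounded n = All (λ a → index a ≤ n)

bounded-weight : ∀ {n} w → weight w ≤ n → Bounded n w
bounded-weight []      _   = []
bounded-weight (a ∷ w) w≤n = ℕₚ.≤-trans (ℕₚ.m≤m+n (index a) (weight w)) w≤n
  ∷ bounded-weight w (ℕₚ.≤-trans (ℕₚ.m≤n+m (weight w) (index a)) w≤n)

-- Coefficients

coeff-∷ : (c : ℤ) (v : Word) (x : ℋ) (w : Word) →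
  coeff ((c , v) ∷ x) w ≡ ι (v ≟ᵂ w) ℤ.* c ℤ.+ coeff x w
coeff-∷ c v x w with v ≟ᵂ w
... | yes _ = cong (ℤ._+ coeff x w) (sym (ℤₚ.*-identityˡ c))
... | no  _ = sym (ℤₚ.+-identityˡ _)

coeff-⊞ : (x y : ℋ) (w : Word) → coeff (x ⊞ y) w ≡ coeff x w ℤ.+ coeff y w
coeff-⊞ []            y w = sym (ℤₚ.+-identityˡ _)
coeff-⊞ ((c , v) ∷ x) y w = begin
  coeff ((c , v) ∷ x ⊞ y) w                          ≡⟨ coeff-∷ c v (x ⊞ y) w ⟩
  ι (v ≟ᵂ w) ℤ.* c ℤ.+ coeff (x ⊞ y) w               ≡⟨ cong (λ y → ι (v ≟ᵂ w) ℤ.* c ℤ.+ y) (coeff-⊞ x y w) ⟩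
  ι (v ≟ᵂ w) ℤ.* c ℤ.+ (coeff x w ℤ.+ coeff y w)     ≡⟨ ℤₚ.+-assoc (ι (v ≟ᵂ w) ℤ.* c) _ _ ⟨
  ι (v ≟ᵂ w) ℤ.* c ℤ.+ coeff x w ℤ.+ coeff y w       ≡⟨ cong (ℤ._+ coeff y w) (coeff-∷ c v x w) ⟨
  coeff ((c , v) ∷ x) w ℤ.+ coeff y w                ∎

coeff-· : (c : ℤ) (x : ℋ) (w : Word) → coeff (c · x) w ≡ c ℤ.* coeff x w
coeff-· c []            w = sym (ℤₚ.*-zeroʳ c)
coeff-· c ((b , v) ∷ x) w = begin
  coeff (c · ((b , v) ∷ x)) w                      ≡⟨ coeff-∷ (c ℤ.* b) v (c · x) w ⟩
  ι (v ≟ᵂ w) ℤ.* (c ℤ.* b) ℤ.+ coeff (c · x) w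
    ≡⟨ cong (λ y → ι (v ≟ᵂ w) ℤ.* (c ℤ.* b) ℤ.+ y) (coeff-· c x w) ⟩
  ι (v ≟ᵂ w) ℤ.* (c ℤ.* b) ℤ.+ c ℤ.* coeff x w     ≡⟨ factor (ι (v ≟ᵂ w)) c b (coeff x w) ⟩
  c ℤ.* (ι (v ≟ᵂ w) ℤ.* b ℤ.+ coeff x w)           ≡⟨ cong (c ℤ.*_) (coeff-∷ b v x w) ⟨
  c ℤ.* coeff ((b , v) ∷ x) w                      ∎
  where
  factor : ∀ i c b y → i ℤ.* (c ℤ.* b) ℤ.+ c ℤ.* y ≡ c ℤ.* (i ℤ.* b ℤ.+ y)
  factor = solve-∀

coeff-∑ : (xs : List A) (f : A → ℋ) (w : Word) → coeff (∑ xs f) w ≡ ⅀ xs (λ x → coeff (f x) w)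
coeff-∑ []       f w = refl
coeff-∑ (x ∷ xs) f w = trans (coeff-⊞ (f x) (∑ xs f) w) (cong (λ y → coeff (f x) w ℤ.+ y) (coeff-∑ xs f w))

coeff-∑-filter : {P : Pred A _} (P? : Decidable P) (xs : List A) (f : A → ℋ) (w : Word) →
  coeff (∑ (filter P? xs) f) w ≡ ⅀ xs (λ x → ι (P? x) ℤ.* coeff (f x) w)
coeff-∑-filter P? xs f w = trans (coeff-∑ (filter P? xs) f w) (⅀-filter P? xs _)

coeff-◁-[] : (s : Letter) (x : ℋ) → coeff (s ◁ x) [] ≡ 0ℤ
coeff-◁-[] s []      = refl
coeff-◁-[] s (_ ∷ x) = coeff-◁-[] s x

coeff-◁-∷ : (s : Letter) (x : ℋ) (a : Letter) (w : Word) →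
  coeff (s ◁ x) (a ∷ w) ≡ ι (s ≟ᴸ a) ℤ.* coeff x w
coeff-◁-∷ s []            a w = sym (ℤₚ.*-zeroʳ (ι (s ≟ᴸ a)))
coeff-◁-∷ s ((c , v) ∷ x) a w = begin
  coeff (s ◁ ((c , v) ∷ x)) (a ∷ w)
    ≡⟨ coeff-∷ c (s ∷ v) (s ◁ x) (a ∷ w) ⟩
  ι ((s ∷ v) ≟ᵂ (a ∷ w)) ℤ.* c ℤ.+ coeff (s ◁ x) (a ∷ w)
    -- On nonempty words `_≟ᵂ_` decides the conjunction of equal heads and equal tails, so its
    -- indicator factors.
    ≡⟨ cong₂ (λ i y → i ℤ.* c ℤ.+ y) (ι-× (s ≟ᴸ a) (v ≟ᵂ w)) (coeff-◁-∷ s x a w) ⟩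
  ι (s ≟ᴸ a) ℤ.* ι (v ≟ᵂ w) ℤ.* c ℤ.+ ι (s ≟ᴸ a) ℤ.* coeff x w
    ≡⟨ factor (ι (s ≟ᴸ a)) (ι (v ≟ᵂ w)) c (coeff x w) ⟩
  ι (s ≟ᴸ a) ℤ.* (ι (v ≟ᵂ w) ℤ.* c ℤ.+ coeff x w)
    ≡⟨ cong (ι (s ≟ᴸ a) ℤ.*_) (coeff-∷ c v x w) ⟨
  ι (s ≟ᴸ a) ℤ.* coeff ((c , v) ∷ x) w                                     ∎
  where
  factor : ∀ i j c y → i ℤ.* j ℤ.* c ℤ.+ i ℤ.* y ≡ i ℤ.* (j ℤ.* c ℤ.+ y)
  factor = solve-∀

-- A bounded word of length `m` occurs exactly once in `words≤ n m`, so only `v = w` contributes.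
-- The induction sifts one letter at a time.
⅀-words-sift : ∀ {n} m {w} → Bounded n w → (f : Word → ℤ) →
  ⅀ (words≤ n m) (λ v → f v ℤ.* coeff ⟦ v ⟧ w) ≡ f w ℤ.* ι (length w ≟ m)
⅀-words-sift zero {[]} [] f = ℤₚ.+-identityʳ _
⅀-words-sift zero {a ∷ w} _ f = trans (ℤₚ.+-identityʳ _) (trans (ℤₚ.*-zeroʳ (f [])) (sym (ℤₚ.*-zeroʳ (f (a ∷ w)))))
⅀-words-sift {n} (suc m) {[]} [] f = begin
  ⅀ (words≤ n (suc m)) (λ v → f v ℤ.* coeff ⟦ v ⟧ [])
    ≡⟨ ⅀-cartesianProductWith _∷_ (letters≤ n) (words≤ n m) _ ⟩
  ⅀ (letters≤ n) (λ s → ⅀ (words≤ n m) (λ v → f (s ∷ v) ℤ.* 0ℤ))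
    ≡⟨ ⅀-zero (letters≤ n) (λ s → ⅀-zero (words≤ n m) (λ v → ℤₚ.*-zeroʳ (f (s ∷ v)))) ⟩
  0ℤ
    ≡⟨ ℤₚ.*-zeroʳ (f []) ⟨
  f [] ℤ.* 0ℤ                                                                                ∎
⅀-words-sift {n} (suc m) {a ∷ w} (a≤n ∷ w≤n) f = begin
  ⅀ (words≤ n (suc m)) (λ v → f v ℤ.* coeff ⟦ v ⟧ (a ∷ w))
    ≡⟨ ⅀-cartesianProductWith _∷_ (letters≤ n) (words≤ n m) _ ⟩
  ⅀ (letters≤ n) (λ s → ⅀ (words≤ n m) (λ v → f (s ∷ v) ℤ.* coeff ⟦ s ∷ v ⟧ (a ∷ w)))
    ≡⟨ ⅀-cong (letters≤ n) (λ s → trans (⅀-cong (words≤ n m) (split s)) (⅀-*ˡ (words≤ n m) (ι (s ≟ᴸ a)) (λ v → f (s ∷ v) ℤ.* coeff ⟦ v ⟧ w))) ⟩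
  ⅀ (letters≤ n) (λ s → ι (s ≟ᴸ a) ℤ.* ⅀ (words≤ n m) (λ v → f (s ∷ v) ℤ.* coeff ⟦ v ⟧ w))
    ≡⟨ ⅀-letters-sift a a≤n _ ⟩
  ⅀ (words≤ n m) (λ v → f (a ∷ v) ℤ.* coeff ⟦ v ⟧ w)
    ≡⟨ ⅀-words-sift m w≤n (λ v → f (a ∷ v)) ⟩
  f (a ∷ w) ℤ.* ι (length w ≟ m)                                                             ∎
  where
  move : ∀ x i y → x ℤ.* (i ℤ.* y) ≡ i ℤ.* (x ℤ.* y)
  move = solve-∀
  split : ∀ s v → f (s ∷ v) ℤ.* coeff ⟦ s ∷ v ⟧ (a ∷ w) ≡ ι (s ≟ᴸ a) ℤ.* (f (s ∷ v) ℤ.* coeff ⟦ v ⟧ w)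
  split s v = trans (cong (f (s ∷ v) ℤ.*_) (coeff-◁-∷ s ⟦ v ⟧ a w)) (move (f (s ∷ v)) (ι (s ≟ᴸ a)) (coeff ⟦ v ⟧ w))

-- Homogeneity in the weight

-- A condition on the listed terms, including those that cancel, so it is stronger than a condition
-- on coefficients and passes through `_◁_` and `_⊞_` term by term.
Homogeneous : ℕ → ℋ → Set
Homogeneous N = All (λ (c , v) → weight v ≡ N)

homogeneous-◁ : ∀ {M N} (s : Letter) {x : ℋ} → index s + M ≡ N → Homogeneous M x → Homogeneous N (s ◁ x)
homogeneous-◁ s s+M≡N hom = map⁺ (All.map (λ v≡M → trans (cong (λ M → index s + M) v≡M) s+M≡N) hom)

stuffle-homogeneous : (u v : Word) → Homogeneous (weight u + weight v) (stuffle u v)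
stuffle-homogeneous []      v  = refl ∷ []
stuffle-homogeneous (r ∷ u) [] = sym (ℕₚ.+-identityʳ _) ∷ []
stuffle-homogeneous (r ∷ u) (s ∷ v) = ++⁺
  (++⁺ (homogeneous-◁ r (left (index r) (weight u) (index s) (weight v)) (stuffle-homogeneous u (s ∷ v)))
       (homogeneous-◁ s (right (index r) (weight u) (index s) (weight v)) (stuffle-homogeneous (r ∷ u) v)))
  (homogeneous-◁ (r ⊕ s) (both (index r) (weight u) (index s) (weight v)) (stuffle-homogeneous u v))
  where
  left : ∀ a b c d → a + (b + (c + d)) ≡ a + b + (c + d)
  left = solveℕ-∀
  right : ∀ a b c d → c + (a + b + d) ≡ a + b + (c + d)
  right = solveℕ-∀
  both : ∀ a b c d → a + c + (b + d) ≡ a + b + (c + d)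
  both = solveℕ-∀

-- A nonzero coefficient at `w` forces `weight w` to be `N`, so the two indicators can differ only
-- where the coefficient vanishes.
homogeneous-coeff : ∀ {N} n (x : ℋ) w → Homogeneous N x →
  ι (N ≟ n) ℤ.* coeff x w ≡ ι (weight w ≟ n) ℤ.* coeff x w
homogeneous-coeff {N} n [] w [] = trans (ℤₚ.*-zeroʳ (ι (N ≟ n))) (sym (ℤₚ.*-zeroʳ (ι (weight w ≟ n))))
homogeneous-coeff {N} n ((c , v) ∷ x) w (v≡N ∷ hom) with v ≟ᵂ w
... | yes v≡w = cong (λ M → ι (M ≟ n) ℤ.* (c ℤ.+ coeff x w)) (trans (sym v≡N) (cong weight v≡w))
... | no  _   = homogeneous-coeff n x w hom

-- Moves the weight constraint from the summation index to the target `w`, where it is a constant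
-- that can be pulled out of the sum.
homogeneous-coeff-× : ∀ {N} n (x : ℋ) w → Homogeneous N x → (b? : Dec B) →
  ι ((N ≟ n) ×-dec b?) ℤ.* coeff x w ≡ ι (weight w ≟ n) ℤ.* (ι b? ℤ.* coeff x w)
homogeneous-coeff-× {N = N} n x w hom b? = begin
  ι ((N ≟ n) ×-dec b?) ℤ.* coeff x w              ≡⟨ cong (ℤ._* coeff x w) (ι-× (N ≟ n) b?) ⟩
  ι (N ≟ n) ℤ.* ι b? ℤ.* coeff x w                ≡⟨ in-front (ι (N ≟ n)) (ι b?) (coeff x w) ⟩
  ι b? ℤ.* (ι (N ≟ n) ℤ.* coeff x w)              ≡⟨ cong (ι b? ℤ.*_) (homogeneous-coeff n x w hom) ⟩
  ι b? ℤ.* (ι (weight w ≟ n) ℤ.* coeff x w)       ≡⟨ exchange (ι b?) (ι (weight w ≟ n)) (coeff x w) ⟩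
  ι (weight w ≟ n) ℤ.* (ι b? ℤ.* coeff x w)       ∎
  where
  in-front : ∀ i j y → i ℤ.* j ℤ.* y ≡ j ℤ.* (i ℤ.* y)
  in-front = solve-∀
  exchange : ∀ i j y → i ℤ.* (j ℤ.* y) ≡ j ℤ.* (i ℤ.* y)
  exchange = solve-∀

coeff-compositions : (k n : ℕ) {P : Pred Word _} (P? : Decidable P) (w : Word) →
  coeff (∑ (compositions k n P?) ⟦_⟧) w ≡ ι (weight w ≟ n) ℤ.* (ι (P? w) ℤ.* ι (length w ≟ k))
coeff-compositions k n P? w = begin
  coeff (∑ (compositions k n P?) ⟦_⟧) w
    ≡⟨ coeff-∑-filter _ (words≤ n k) ⟦_⟧ w ⟩
  ⅀ (words≤ n k) (λ t → ι ((weight t ≟ n) ×-dec P? t) ℤ.* coeff ⟦ t ⟧ w)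
    ≡⟨ ⅀-cong (words≤ n k) (λ t → homogeneous-coeff-× n ⟦ t ⟧ w (refl ∷ []) (P? t)) ⟩
  ⅀ (words≤ n k) (λ t → ι (weight w ≟ n) ℤ.* (ι (P? t) ℤ.* coeff ⟦ t ⟧ w))
    ≡⟨ ⅀-*ˡ (words≤ n k) (ι (weight w ≟ n)) (λ t → ι (P? t) ℤ.* coeff ⟦ t ⟧ w) ⟩
  ι (weight w ≟ n) ℤ.* ⅀ (words≤ n k) (λ t → ι (P? t) ℤ.* coeff ⟦ t ⟧ w)
    -- Letters of a word of weight `n` have index at most `n`, which is the bound that sifting
    -- demands.
    ≡⟨ ι-*-cong (weight w ≟ n) (λ w≡n → ⅀-words-sift k (bounded-weight w (ℕₚ.≤-reflexive w≡n)) (ι ∘ P?)) ⟩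
  ι (weight w ≟ n) ℤ.* (ι (P? w) ℤ.* ι (length w ≟ k)) ∎

-- Stuffling a letter into a word

-- The coefficient of `w` in the sum of all `z_r ∗ s` with weight factor `h s`, where `s` has length
-- `m` and the total weight is free. The factor is a parameter because the recursion on `w` replaces
-- the condition on the first letter by `const 1ℤ`.
stuffleSum : (n m : ℕ) → (Word → ℤ) → Word → ℤ
stuffleSum n m h w = ⅀ (letters≤ n) λ r → ⅀ (words≤ n m) λ s → h s ℤ.* coeff (stuffle [ r ] s) w

coeff-stuffle-[] : (r : Letter) (s : Word) → coeff (stuffle [ r ] s) [] ≡ 0ℤ
coeff-stuffle-[] r []      = refl
coeff-stuffle-[] r (s ∷ v) = begin
  coeff (r ◁ ⟦ s ∷ v ⟧ ⊞ s ◁ stuffle [ r ] v ⊞ (r ⊕ s) ◁ ⟦ v ⟧) []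
    ≡⟨ coeff-⊞ (s ◁ stuffle [ r ] v) ((r ⊕ s) ◁ ⟦ v ⟧) [] ⟩
  coeff (s ◁ stuffle [ r ] v) [] ℤ.+ 0ℤ                             ≡⟨ ℤₚ.+-identityʳ _ ⟩
  coeff (s ◁ stuffle [ r ] v) []                                    ≡⟨ coeff-◁-[] s (stuffle [ r ] v) ⟩
  0ℤ                                                                ∎

coeff-stuffle-∷ : (r s : Letter) (v : Word) (a : Letter) (w : Word) →
  coeff (stuffle [ r ] (s ∷ v)) (a ∷ w)
    ≡ ι (r ≟ᴸ a) ℤ.* coeff ⟦ s ∷ v ⟧ w
      ℤ.+ ι (s ≟ᴸ a) ℤ.* coeff (stuffle [ r ] v) w
      ℤ.+ ι ((r ⊕ s) ≟ᴸ a) ℤ.* coeff ⟦ v ⟧ w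
coeff-stuffle-∷ r s v a w = begin
  coeff (x ⊞ y ⊞ t) (a ∷ w)                                         ≡⟨ coeff-⊞ (x ⊞ y) t (a ∷ w) ⟩
  coeff (x ⊞ y) (a ∷ w) ℤ.+ coeff t (a ∷ w)
    ≡⟨ cong (ℤ._+ coeff t (a ∷ w)) (coeff-⊞ x y (a ∷ w)) ⟩
  coeff x (a ∷ w) ℤ.+ coeff y (a ∷ w) ℤ.+ coeff t (a ∷ w)
    ≡⟨ cong₂ ℤ._+_ (cong₂ ℤ._+_ (coeff-◁-∷ r ⟦ s ∷ v ⟧ a w) (coeff-◁-∷ s (stuffle [ r ] v) a w)) (coeff-◁-∷ (r ⊕ s) ⟦ v ⟧ a w) ⟩
  _                                                                 ∎
  where
  x = r ◁ ⟦ s ∷ v ⟧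
  y = s ◁ stuffle [ r ] v
  t = (r ⊕ s) ◁ ⟦ v ⟧

stuffleSum-[] : (n m : ℕ) (h : Word → ℤ) → stuffleSum n m h [] ≡ 0ℤ
stuffleSum-[] n m h = ⅀-zero (letters≤ n) λ r → ⅀-zero (words≤ n m) λ s →
  trans (cong (h s ℤ.*_) (coeff-stuffle-[] r s)) (ℤₚ.*-zeroʳ (h s))

-- The three summands record whether the first letter a of the target is r, is
-- the first letter s of the other factor, or is r ⊕ s.
stuffleSum-∷ : ∀ {n a w} (m : ℕ) (h : Word → ℤ) (g : Letter → ℤ) → (∀ s v → h (s ∷ v) ≡ g s) →
  Bounded n (a ∷ w) →
  stuffleSum n (suc m) h (a ∷ w)
    ≡ h w ℤ.* ι (length w ≟ suc m)
      ℤ.+ g a ℤ.* stuffleSum n m (const 1ℤ) w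
      ℤ.+ ⅀ (letters≤ n) (λ s → g s ℤ.* ι (index s <? index a)) ℤ.* ι (length w ≟ m)
stuffleSum-∷ {n} {a} {w} m h g h≗g (a≤n ∷ w≤n) = begin
  stuffleSum n (suc m) h (a ∷ w)
    ≡⟨ ⅀-cong L (λ r → trans (⅀-cartesianProductWith _∷_ L W _)
         (trans (⅀-cong L (λ s → trans (⅀-cong W (term r s)) (⅀-+₃ W))) (⅀-+₃ L))) ⟩
  ⅀ L (λ r → ⅀ L (λ s → ⅀ W (X r s)) ℤ.+ ⅀ L (λ s → ⅀ W (Y r s)) ℤ.+ ⅀ L (λ s → ⅀ W (Z r s)))
    ≡⟨ ⅀-+₃ L ⟩
  ⅀ L (λ r → ⅀ L (λ s → ⅀ W (X r s))) ℤ.+ ⅀ L (λ r → ⅀ L (λ s → ⅀ W (Y r s))) ℤ.+ ⅀ L (λ r → ⅀ L (λ s → ⅀ W (Z r s)))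
    ≡⟨ cong₂ ℤ._+_ (cong₂ ℤ._+_ sumX sumY) sumZ ⟩
  _ ∎
  where
  L = letters≤ n
  W = words≤ n m
  X Y Z : Letter → Letter → Word → ℤ
  -- `X` keeps `h (s ∷ v)` in place of `g s`, so that the sums over `s` and `v` refold into one sum
  -- over words of length `suc m`.
  X r s v = ι (r ≟ᴸ a) ℤ.* (h (s ∷ v) ℤ.* coeff ⟦ s ∷ v ⟧ w)
  Y r s v = ι (s ≟ᴸ a) ℤ.* (g s ℤ.* (1ℤ ℤ.* coeff (stuffle [ r ] v) w))
  Z r s v = g s ℤ.* ι ((r ⊕ s) ≟ᴸ a) ℤ.* (1ℤ ℤ.* coeff ⟦ v ⟧ w)
  ⅀-+₃ : (xs : List A) {f f′ f″ : A → ℤ} →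
    ⅀ xs (λ x → f x ℤ.+ f′ x ℤ.+ f″ x) ≡ ⅀ xs f ℤ.+ ⅀ xs f′ ℤ.+ ⅀ xs f″
  ⅀-+₃ xs {f} {f′} {f″} = trans (⅀-+ xs _ f″) (cong (ℤ._+ ⅀ xs f″) (⅀-+ xs f f′))
  distrib : ∀ x i p j q k t → x ℤ.* (i ℤ.* p ℤ.+ j ℤ.* q ℤ.+ k ℤ.* t)
    ≡ i ℤ.* (x ℤ.* p) ℤ.+ j ℤ.* (x ℤ.* (1ℤ ℤ.* q)) ℤ.+ x ℤ.* k ℤ.* (1ℤ ℤ.* t)
  distrib = solve-∀
  term : ∀ r s v → h (s ∷ v) ℤ.* coeff (stuffle [ r ] (s ∷ v)) (a ∷ w) ≡ X r s v ℤ.+ Y r s v ℤ.+ Z r s v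
  term r s v = begin
    h (s ∷ v) ℤ.* coeff (stuffle [ r ] (s ∷ v)) (a ∷ w)
      ≡⟨ cong₂ ℤ._*_ (h≗g s v) (coeff-stuffle-∷ r s v a w) ⟩
    g s ℤ.* _
      ≡⟨ distrib (g s) (ι (r ≟ᴸ a)) (coeff ⟦ s ∷ v ⟧ w) (ι (s ≟ᴸ a)) (coeff (stuffle [ r ] v) w) (ι ((r ⊕ s) ≟ᴸ a)) (coeff ⟦ v ⟧ w) ⟩
    ι (r ≟ᴸ a) ℤ.* (g s ℤ.* coeff ⟦ s ∷ v ⟧ w) ℤ.+ Y r s v ℤ.+ Z r s v
      ≡⟨ cong (λ x → ι (r ≟ᴸ a) ℤ.* (x ℤ.* coeff ⟦ s ∷ v ⟧ w) ℤ.+ Y r s v ℤ.+ Z r s v) (h≗g s v) ⟨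
    X r s v ℤ.+ Y r s v ℤ.+ Z r s v ∎
  sumX : ⅀ L (λ r → ⅀ L (λ s → ⅀ W (X r s))) ≡ h w ℤ.* ι (length w ≟ suc m)
  sumX = begin
    ⅀ L (λ r → ⅀ L (λ s → ⅀ W (X r s)))
      ≡⟨ ⅀-cong L (λ r → trans (sym (⅀-cartesianProductWith _∷_ L W _)) (⅀-*ˡ (words≤ n (suc m)) (ι (r ≟ᴸ a)) (λ v → h v ℤ.* coeff ⟦ v ⟧ w))) ⟩
    ⅀ L (λ r → ι (r ≟ᴸ a) ℤ.* ⅀ (words≤ n (suc m)) (λ v → h v ℤ.* coeff ⟦ v ⟧ w))
      ≡⟨ ⅀-letters-sift a a≤n _ ⟩
    ⅀ (words≤ n (suc m)) (λ v → h v ℤ.* coeff ⟦ v ⟧ w)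
      ≡⟨ ⅀-words-sift (suc m) w≤n h ⟩
    h w ℤ.* ι (length w ≟ suc m) ∎
  sumY : ⅀ L (λ r → ⅀ L (λ s → ⅀ W (Y r s))) ≡ g a ℤ.* stuffleSum n m (const 1ℤ) w
  sumY = begin
    ⅀ L (λ r → ⅀ L (λ s → ⅀ W (Y r s)))
      ≡⟨ ⅀-cong L (λ r → ⅀-cong L (λ s → trans
           (⅀-*ˡ W (ι (s ≟ᴸ a)) (λ v → g s ℤ.* (1ℤ ℤ.* coeff (stuffle [ r ] v) w)))
           (cong (ι (s ≟ᴸ a) ℤ.*_) (⅀-*ˡ W (g s) (λ v → 1ℤ ℤ.* coeff (stuffle [ r ] v) w))))) ⟩
    ⅀ L (λ r → ⅀ L (λ s → ι (s ≟ᴸ a) ℤ.* (g s ℤ.* ⅀ W (λ v → 1ℤ ℤ.* coeff (stuffle [ r ] v) w))))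
      ≡⟨ ⅀-cong L (λ r → ⅀-letters-sift a a≤n _) ⟩
    ⅀ L (λ r → g a ℤ.* ⅀ W (λ v → 1ℤ ℤ.* coeff (stuffle [ r ] v) w))
      ≡⟨ ⅀-*ˡ L (g a) _ ⟩
    g a ℤ.* stuffleSum n m (const 1ℤ) w ∎
  sumZ : ⅀ L (λ r → ⅀ L (λ s → ⅀ W (Z r s)))
    ≡ ⅀ L (λ s → g s ℤ.* ι (index s <? index a)) ℤ.* ι (length w ≟ m)
  sumZ = begin
    ⅀ L (λ r → ⅀ L (λ s → ⅀ W (Z r s)))
      ≡⟨ ⅀-cong L (λ r → ⅀-cong L (λ s → trans (⅀-*ˡ W (g s ℤ.* ι ((r ⊕ s) ≟ᴸ a)) (λ v → 1ℤ ℤ.* coeff ⟦ v ⟧ w))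
           (cong (g s ℤ.* ι ((r ⊕ s) ≟ᴸ a) ℤ.*_) (trans (⅀-words-sift m w≤n (const 1ℤ)) (ℤₚ.*-identityˡ _))))) ⟩
    ⅀ L (λ r → ⅀ L (λ s → g s ℤ.* ι ((r ⊕ s) ≟ᴸ a) ℤ.* ι (length w ≟ m)))
      -- For fixed `s`, summing over `r` first counts the solutions of `r ⊕ s = a`: one if
      -- `index s < index a`, otherwise none.
      ≡⟨ ⅀-swap L L _ ⟩
    ⅀ L (λ s → ⅀ L (λ r → g s ℤ.* ι ((r ⊕ s) ≟ᴸ a) ℤ.* ι (length w ≟ m)))
      ≡⟨ ⅀-cong L (λ s → trans (⅀-*ʳ L _ _) (cong (ℤ._* ι (length w ≟ m))
           (trans (⅀-*ˡ L (g s) _) (cong (g s ℤ.*_) (⅀-letters-⊕ a s a≤n))))) ⟩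
    ⅀ L (λ s → g s ℤ.* ι (index s <? index a) ℤ.* ι (length w ≟ m))
      ≡⟨ ⅀-*ʳ L _ _ ⟩
    ⅀ L (λ s → g s ℤ.* ι (index s <? index a)) ℤ.* ι (length w ≟ m) ∎

-- A word of length m + 1 arises by inserting r at any of its m + 1 positions; a
-- word of length m arises by splitting one letter a as r ⊕ s, in a − 1 ways.
stuffleSum-1 : ∀ {n w} (m : ℕ) → Bounded n w →
  stuffleSum n m (const 1ℤ) w
    ≡ (1ℤ ℤ.+ + m) ℤ.* ι (length w ≟ suc m) ℤ.+ (+ weight w ℤ.- + m) ℤ.* ι (length w ≟ m)
-- Here the second length indicator is 1, but its factor `+ 0 ℤ.- + 0` is zero.
stuffleSum-1 {n} {[]} zero    [] = stuffleSum-[] n zero (const 1ℤ)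
stuffleSum-1 {n} {[]} (suc m) [] = trans (stuffleSum-[] n (suc m) (const 1ℤ))
  (vanish (1ℤ ℤ.+ + suc m) (+ 0 ℤ.- + suc m))
  where
  vanish : ∀ x y → 0ℤ ≡ x ℤ.* 0ℤ ℤ.+ y ℤ.* 0ℤ
  vanish = solve-∀
stuffleSum-1 {n} {a ∷ w} zero (a≤n ∷ w≤n) = begin
  -- The only `s` of length 0 is the empty word, and `stuffle [ r ] []` is `⟦ [ r ] ⟧`.
  ⅀ L (λ r → 1ℤ ℤ.* coeff ⟦ [ r ] ⟧ (a ∷ w) ℤ.+ 0ℤ)
    ≡⟨ ⅀-cong L (λ r → trans (simplify (coeff ⟦ [ r ] ⟧ (a ∷ w))) (coeff-◁-∷ r ⟦ [] ⟧ a w)) ⟩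
  ⅀ L (λ r → ι (r ≟ᴸ a) ℤ.* coeff ⟦ [] ⟧ w)
    ≡⟨ ⅀-letters-sift a a≤n _ ⟩
  coeff ⟦ [] ⟧ w
    ≡⟨ empty w ⟩
  ι (length w ≟ 0)
    ≡⟨ expand (ι (length w ≟ 0)) (+ weight (a ∷ w) ℤ.- 0ℤ) ⟩
  1ℤ ℤ.* ι (length w ≟ 0) ℤ.+ (+ weight (a ∷ w) ℤ.- 0ℤ) ℤ.* 0ℤ ∎
  where
  L = letters≤ n
  simplify : ∀ x → 1ℤ ℤ.* x ℤ.+ 0ℤ ≡ x
  simplify = solve-∀
  expand : ∀ x y → x ≡ 1ℤ ℤ.* x ℤ.+ y ℤ.* 0ℤ
  expand = solve-∀
  empty : ∀ w → coeff ⟦ [] ⟧ w ≡ ι (length w ≟ 0)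
  empty []      = refl
  empty (_ ∷ _) = refl
stuffleSum-1 {n} {a ∷ w} (suc m) (a≤n ∷ w≤n) = begin
  stuffleSum n (suc m) (const 1ℤ) (a ∷ w)
    ≡⟨ stuffleSum-∷ m (const 1ℤ) (const 1ℤ) (λ _ _ → refl) (a≤n ∷ w≤n) ⟩
  1ℤ ℤ.* I ℤ.+ 1ℤ ℤ.* stuffleSum n m (const 1ℤ) w ℤ.+ ⅀ (letters≤ n) (λ s → 1ℤ ℤ.* ι (index s <? index a)) ℤ.* J
    ≡⟨ cong₂ (λ x y → 1ℤ ℤ.* I ℤ.+ 1ℤ ℤ.* x ℤ.+ y ℤ.* J) (stuffleSum-1 m w≤n) (⅀-letters-< a a≤n) ⟩
  1ℤ ℤ.* I ℤ.+ 1ℤ ℤ.* ((1ℤ ℤ.+ + m) ℤ.* I ℤ.+ (+ weight w ℤ.- + m) ℤ.* J) ℤ.+ (+ index a ℤ.- 1ℤ) ℤ.* J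
    -- Inserting in front of `a` adds one to the `m + 1` later positions; splitting `a` adds
    -- `index a - 1` to the splittings of `w`.
    ≡⟨ collect I J (+ m) (+ index a) (+ weight w) ⟩
  (1ℤ ℤ.+ (1ℤ ℤ.+ + m)) ℤ.* I ℤ.+ (+ index a ℤ.+ + weight w ℤ.- (1ℤ ℤ.+ + m)) ℤ.* J ∎
  where
  I = ι (length w ≟ suc m)
  J = ι (length w ≟ m)
  collect : ∀ I J m a w →
    1ℤ ℤ.* I ℤ.+ 1ℤ ℤ.* ((1ℤ ℤ.+ m) ℤ.* I ℤ.+ (w ℤ.- m) ℤ.* J) ℤ.+ (a ℤ.- 1ℤ) ℤ.* J
    ≡ (1ℤ ℤ.+ (1ℤ ℤ.+ m)) ℤ.* I ℤ.+ (a ℤ.+ w ℤ.- (1ℤ ℤ.+ m)) ℤ.* J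
  collect = solve-∀

-- Coefficients of the left-hand side and comparison with the right-hand side

coeff-letterCompositions : (m n : ℕ) {P : Pred Word _} (P? : Decidable P) (w : Word) →
  coeff (∑ (letterCompositions m n P?) (λ (r , s) → ⟦ [ r ] ⟧ ∗ ⟦ s ⟧)) w
    ≡ ι (weight w ≟ n) ℤ.* stuffleSum n m (ι ∘ P?) w
coeff-letterCompositions m n P? w = begin
  coeff (∑ (letterCompositions m n P?) (λ (r , s) → ⟦ [ r ] ⟧ ∗ ⟦ s ⟧)) w
    ≡⟨ coeff-∑-filter _ (cartesianProductWith _,_ L W) _ w ⟩
  ⅀ (cartesianProductWith _,_ L W) _
    ≡⟨ ⅀-cartesianProductWith _,_ L W _ ⟩
  ⅀ L (λ r → ⅀ W (λ s → ι ((index r + weight s ≟ n) ×-dec P? s) ℤ.* coeff (⟦ [ r ] ⟧ ∗ ⟦ s ⟧) w))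
    ≡⟨ ⅀-cong L (λ r → trans (⅀-cong W (term r)) (⅀-*ˡ W (ι (weight w ≟ n)) (λ s → ι (P? s) ℤ.* coeff (stuffle [ r ] s) w))) ⟩
  ⅀ L (λ r → ι (weight w ≟ n) ℤ.* ⅀ W (λ s → ι (P? s) ℤ.* coeff (stuffle [ r ] s) w))
    ≡⟨ ⅀-*ˡ L (ι (weight w ≟ n)) (λ r → ⅀ W (λ s → ι (P? s) ℤ.* coeff (stuffle [ r ] s) w)) ⟩
  ι (weight w ≟ n) ℤ.* stuffleSum n m (ι ∘ P?) w ∎
  where
  L = letters≤ n
  W = words≤ n m
  coeff-∗ : ∀ r s → coeff (⟦ [ r ] ⟧ ∗ ⟦ s ⟧) w ≡ coeff (stuffle [ r ] s) w
  coeff-∗ r s = begin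
    coeff (((1ℤ · stuffle [ r ] s) ++ []) ++ []) w
      -- Both sums in `_∗_` run over a single term, which leaves two trailing `++ []`.
      ≡⟨ cong (λ x → coeff x w) (trans (++-identityʳ (x ++ [])) (++-identityʳ x)) ⟩
    coeff (1ℤ · stuffle [ r ] s) w                     ≡⟨ coeff-· 1ℤ (stuffle [ r ] s) w ⟩
    1ℤ ℤ.* coeff (stuffle [ r ] s) w                   ≡⟨ ℤₚ.*-identityˡ _ ⟩
    coeff (stuffle [ r ] s) w                          ∎
    where x = 1ℤ · stuffle [ r ] s
  term : ∀ r s → ι ((index r + weight s ≟ n) ×-dec P? s) ℤ.* coeff (⟦ [ r ] ⟧ ∗ ⟦ s ⟧) w
    ≡ ι (weight w ≟ n) ℤ.* (ι (P? s) ℤ.* coeff (stuffle [ r ] s) w)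
  term r s = trans (cong (ι ((index r + weight s ≟ n) ×-dec P? s) ℤ.*_) (coeff-∗ r s))
    (homogeneous-coeff-× n (stuffle [ r ] s) w hom (P? s))
    where
    hom : Homogeneous (index r + weight s) (stuffle [ r ] s)
    -- `weight [ r ]` unfolds to `index r + 0`.
    hom = subst (λ i → Homogeneous (i + weight s) (stuffle [ r ] s)) (ℕₚ.+-identityʳ (index r))
      (stuffle-homogeneous [ r ] s)

-- Put `k = m + 2`. Inserting `r` in front leaves the tail of `w` as `s`, so the second letter must
-- be at least 2; inserting it at one of the `k - 1` later positions keeps the first letter, which
-- must then be at least 2. This gives 1, `k - 1` or `k` ways in the three cases. For a first letter
-- `a` of index at least 2, splittings number `index a - 2` at `a` and, with `v` the tail of `w`,
-- `weight v - m` further on, in total `weight w - k`. The bound `weight w` makes all letters of `w`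
-- admissible.
stuffleSum-first : ∀ (m : ℕ) (w : Word) →
  stuffleSum (weight w) (suc m) (ι ∘ first? (2 ≤?_)) w
    ≡ ι (first? (_≟ 1) w ×-dec second? (2 ≤?_) w) ℤ.* ι (length w ≟ suc (suc m))
      ℤ.+ (1ℤ ℤ.+ + m) ℤ.* (ι (first? (2 ≤?_) w ×-dec second? (_≟ 1) w) ℤ.* ι (length w ≟ suc (suc m)))
      ℤ.+ (+ 2 ℤ.+ + m) ℤ.* (ι (first? (2 ≤?_) w ×-dec second? (2 ≤?_) w) ℤ.* ι (length w ≟ suc (suc m)))
      ℤ.+ (+ weight w ℤ.- (+ 2 ℤ.+ + m)) ℤ.* (ι (first? (2 ≤?_) w) ℤ.* ι (length w ≟ suc m))
stuffleSum-first m [] = trans (stuffleSum-[] 0 (suc m) (ι ∘ first? (2 ≤?_))) (vanish (+ m))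
  where
  vanish : ∀ m → 0ℤ ≡ 0ℤ ℤ.+ (1ℤ ℤ.+ m) ℤ.* 0ℤ ℤ.+ (+ 2 ℤ.+ m) ℤ.* 0ℤ ℤ.+ (0ℤ ℤ.- (+ 2 ℤ.+ m)) ℤ.* 0ℤ
  vanish = solve-∀
stuffleSum-first m (a ∷ w) = trans
  (trans (stuffleSum-∷ m (ι ∘ first? (2 ≤?_)) (λ s → ι (2 ≤? index s)) (λ _ _ → refl) bounded)
    (cong₂ (λ x y → ι (first? (2 ≤?_) w) ℤ.* I ℤ.+ ι (2 ≤? index a) ℤ.* x ℤ.+ y ℤ.* J)
      (stuffleSum-1 m (All.tail bounded)) (⅀-letters-2≤< a (All.head bounded))))
  (cases a w)
  where
  I = ι (length w ≟ suc m)
  J = ι (length w ≟ m)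
  bounded : Bounded (weight (a ∷ w)) (a ∷ w)
  bounded = bounded-weight (a ∷ w) ℕₚ.≤-refl
  -- Matching on the leading letters, as far as each case demands, makes the indicators about them
  -- compute; both sides then agree as polynomials in the remaining quantities.
  cases : ∀ a w → let I = ι (length w ≟ suc m); J = ι (length w ≟ m) in
    ι (first? (2 ≤?_) w) ℤ.* I
      ℤ.+ ι (2 ≤? index a) ℤ.* ((1ℤ ℤ.+ + m) ℤ.* I ℤ.+ (+ weight w ℤ.- + m) ℤ.* J)
      ℤ.+ + (index a ∸ 2) ℤ.* J
    ≡ ι ((index a ≟ 1) ×-dec first? (2 ≤?_) w) ℤ.* I
      ℤ.+ (1ℤ ℤ.+ + m) ℤ.* (ι ((2 ≤? index a) ×-dec first? (_≟ 1) w) ℤ.* I)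
      ℤ.+ (+ 2 ℤ.+ + m) ℤ.* (ι ((2 ≤? index a) ×-dec first? (2 ≤?_) w) ℤ.* I)
      ℤ.+ (+ index a ℤ.+ + weight w ℤ.- (+ 2 ℤ.+ + m)) ℤ.* (ι (2 ≤? index a) ℤ.* J)
  cases (z 1) w = first1 (ι (first? (2 ≤?_) w)) (ι (length w ≟ suc m)) (ι (length w ≟ m)) (+ m) (+ weight w)
    where
    first1 : ∀ f I J m w →
      f ℤ.* I ℤ.+ 0ℤ ℤ.* ((1ℤ ℤ.+ m) ℤ.* I ℤ.+ (w ℤ.- m) ℤ.* J) ℤ.+ 0ℤ ℤ.* J
      ≡ f ℤ.* I ℤ.+ (1ℤ ℤ.+ m) ℤ.* (0ℤ ℤ.* I) ℤ.+ (+ 2 ℤ.+ m) ℤ.* (0ℤ ℤ.* I) ℤ.+ (1ℤ ℤ.+ w ℤ.- (+ 2 ℤ.+ m)) ℤ.* (0ℤ ℤ.* J)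
    first1 = solve-∀
  -- A one-letter target has no second letter, so the three insertion terms vanish and only
  -- splitting the letter remains.
  cases (z (suc (suc b))) [] = short (ι (0 ≟ m)) (+ m) (+ b)
    where
    short : ∀ J m b →
      0ℤ ℤ.* 0ℤ ℤ.+ 1ℤ ℤ.* ((1ℤ ℤ.+ m) ℤ.* 0ℤ ℤ.+ (0ℤ ℤ.- m) ℤ.* J) ℤ.+ b ℤ.* J
      ≡ 0ℤ ℤ.* 0ℤ ℤ.+ (1ℤ ℤ.+ m) ℤ.* (0ℤ ℤ.* 0ℤ) ℤ.+ (+ 2 ℤ.+ m) ℤ.* (0ℤ ℤ.* 0ℤ)
        ℤ.+ (+ 2 ℤ.+ b ℤ.+ 0ℤ ℤ.- (+ 2 ℤ.+ m)) ℤ.* (1ℤ ℤ.* J)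
    short = solve-∀
  cases (z (suc (suc b))) w@(z 1 ∷ _) = second1 (ι (length w ≟ suc m)) (ι (length w ≟ m)) (+ m) (+ b) (+ weight w)
    where
    second1 : ∀ I J m b w →
      0ℤ ℤ.* I ℤ.+ 1ℤ ℤ.* ((1ℤ ℤ.+ m) ℤ.* I ℤ.+ (w ℤ.- m) ℤ.* J) ℤ.+ b ℤ.* J
      ≡ 0ℤ ℤ.* I ℤ.+ (1ℤ ℤ.+ m) ℤ.* (1ℤ ℤ.* I) ℤ.+ (+ 2 ℤ.+ m) ℤ.* (0ℤ ℤ.* I)
        ℤ.+ (+ 2 ℤ.+ b ℤ.+ w ℤ.- (+ 2 ℤ.+ m)) ℤ.* (1ℤ ℤ.* J)
    second1 = solve-∀
  cases (z (suc (suc b))) w@(z (suc (suc _)) ∷ _) = second2 (ι (length w ≟ suc m)) (ι (length w ≟ m)) (+ m) (+ b) (+ weight w)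
    where
    second2 : ∀ I J m b w →
      1ℤ ℤ.* I ℤ.+ 1ℤ ℤ.* ((1ℤ ℤ.+ m) ℤ.* I ℤ.+ (w ℤ.- m) ℤ.* J) ℤ.+ b ℤ.* J
      ≡ 0ℤ ℤ.* I ℤ.+ (1ℤ ℤ.+ m) ℤ.* (0ℤ ℤ.* I) ℤ.+ (+ 2 ℤ.+ m) ℤ.* (1ℤ ℤ.* I)
        ℤ.+ (+ 2 ℤ.+ b ℤ.+ w ℤ.- (+ 2 ℤ.+ m)) ℤ.* (1ℤ ℤ.* J)
    second2 = solve-∀

theorem2p4 : (k n : ℕ) → 2 ≤ k → k + 1 ≤ n →
    ∑ (letterCompositions (k ∸ 1) n (first? (2 ≤?_))) (λ (r , s) → ⟦ [ r ] ⟧ ∗ ⟦ s ⟧)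
    ≈ ∑ (compositions k n (λ t → first? (_≟ 1) t ×-dec second? (2 ≤?_) t)) ⟦_⟧
    ⊞ (+ k ℤ.- + 1) · ∑ (compositions k n (λ t → first? (2 ≤?_) t ×-dec second? (_≟ 1) t)) ⟦_⟧
    ⊞ (+ k) · ∑ (compositions k n (λ t → first? (2 ≤?_) t ×-dec second? (2 ≤?_) t)) ⟦_⟧
    ⊞ (+ n ℤ.- + k) · ∑ (compositions (k ∸ 1) n (first? (2 ≤?_))) ⟦_⟧
theorem2p4 1 n (s≤s ()) _ w
theorem2p4 k@(suc (suc m)) n _ _ w = begin
  coeff (∑ (letterCompositions (suc m) n (first? (2 ≤?_))) (λ (r , s) → ⟦ [ r ] ⟧ ∗ ⟦ s ⟧)) w
    ≡⟨ coeff-letterCompositions (suc m) n (first? (2 ≤?_)) w ⟩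
  ι (weight w ≟ n) ℤ.* stuffleSum n (suc m) (ι ∘ first? (2 ≤?_)) w
    -- Matching `refl` replaces the bound `n` by `weight w`. With `k = suc (suc m)`, `c₂` and `c₃`
    -- compute to the factors `1ℤ ℤ.+ + m` and `+ 2 ℤ.+ + m`.
    ≡⟨ ι-*-cong (weight w ≟ n) (λ { refl → stuffleSum-first m w }) ⟩
  ι (weight w ≟ n) ℤ.* (p₁ ℤ.+ c₂ ℤ.* p₂ ℤ.+ c₃ ℤ.* p₃ ℤ.+ c₄ ℤ.* p₄)
    ≡⟨ distrib (ι (weight w ≟ n)) p₁ c₂ p₂ c₃ p₃ c₄ p₄ ⟩
  ι (weight w ≟ n) ℤ.* p₁ ℤ.+ c₂ ℤ.* (ι (weight w ≟ n) ℤ.* p₂) ℤ.+ c₃ ℤ.* (ι (weight w ≟ n) ℤ.* p₃) ℤ.+ c₄ ℤ.* (ι (weight w ≟ n) ℤ.* p₄)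
    ≡⟨ cong₂ ℤ._+_ (cong₂ ℤ._+_ (cong₂ ℤ._+_
         (coeff-compositions k n (λ t → first? (_≟ 1) t ×-dec second? (2 ≤?_) t) w)
         (coeff-·-compositions c₂ k (λ t → first? (2 ≤?_) t ×-dec second? (_≟ 1) t)))
         (coeff-·-compositions c₃ k (λ t → first? (2 ≤?_) t ×-dec second? (2 ≤?_) t)))
         (coeff-·-compositions c₄ (suc m) (first? (2 ≤?_))) ⟨
  coeff x₁ w ℤ.+ coeff x₂ w ℤ.+ coeff x₃ w ℤ.+ coeff x₄ w
    ≡⟨ cong (λ y → y ℤ.+ coeff x₃ w ℤ.+ coeff x₄ w) (coeff-⊞ x₁ x₂ w) ⟨
  coeff (x₁ ⊞ x₂) w ℤ.+ coeff x₃ w ℤ.+ coeff x₄ w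
    ≡⟨ cong (ℤ._+ coeff x₄ w) (coeff-⊞ (x₁ ⊞ x₂) x₃ w) ⟨
  coeff (x₁ ⊞ x₂ ⊞ x₃) w ℤ.+ coeff x₄ w
    ≡⟨ coeff-⊞ (x₁ ⊞ x₂ ⊞ x₃) x₄ w ⟨
  coeff (x₁ ⊞ x₂ ⊞ x₃ ⊞ x₄) w ∎
  where
  c₂ = + k ℤ.- + 1
  c₃ = + k
  c₄ = + n ℤ.- + k
  p₁ = ι (first? (_≟ 1) w ×-dec second? (2 ≤?_) w) ℤ.* ι (length w ≟ k)
  p₂ = ι (first? (2 ≤?_) w ×-dec second? (_≟ 1) w) ℤ.* ι (length w ≟ k)
  p₃ = ι (first? (2 ≤?_) w ×-dec second? (2 ≤?_) w) ℤ.* ι (length w ≟ k)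
  p₄ = ι (first? (2 ≤?_) w) ℤ.* ι (length w ≟ suc m)
  x₁ = ∑ (compositions k n (λ t → first? (_≟ 1) t ×-dec second? (2 ≤?_) t)) ⟦_⟧
  x₂ = c₂ · ∑ (compositions k n (λ t → first? (2 ≤?_) t ×-dec second? (_≟ 1) t)) ⟦_⟧
  x₃ = c₃ · ∑ (compositions k n (λ t → first? (2 ≤?_) t ×-dec second? (2 ≤?_) t)) ⟦_⟧
  x₄ = c₄ · ∑ (compositions (suc m) n (first? (2 ≤?_))) ⟦_⟧
  distrib : ∀ i p₁ c₂ p₂ c₃ p₃ c₄ p₄ → i ℤ.* (p₁ ℤ.+ c₂ ℤ.* p₂ ℤ.+ c₃ ℤ.* p₃ ℤ.+ c₄ ℤ.* p₄)
    ≡ i ℤ.* p₁ ℤ.+ c₂ ℤ.* (i ℤ.* p₂) ℤ.+ c₃ ℤ.* (i ℤ.* p₃) ℤ.+ c₄ ℤ.* (i ℤ.* p₄)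
  distrib = solve-∀
  coeff-·-compositions : ∀ c l {P : Pred Word _} (P? : Decidable P) →
    coeff (c · ∑ (compositions l n P?) ⟦_⟧) w ≡ c ℤ.* (ι (weight w ≟ n) ℤ.* (ι (P? w) ℤ.* ι (length w ≟ l)))
  coeff-·-compositions c l P? = trans (coeff-· c (∑ (compositions l n P?) ⟦_⟧) w) (cong (c ℤ.*_) (coeff-compositions l n P? w))
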